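{- For every integer $\ell \ge 3$, every $C_{\ell+1}$-free graph $G\neq K_\ell$ of chromatic number $\chi < \frac{5\ell+2}{3}$ satisfies $\varphi(G) \ge \chi - \ell + 1$.
   Context: All graphs are finite, simple and non-empty. $C_{\ell+1}$-free means $G$ contains no cycle of length exactly $\ell+1$ as a (not necessarily induced) subgraph. For a proper colouring $\sigma$ of $G$, $\varphi_\sigma(G)=\max_{H}\big(|\sigma(V(H))|-\chi(H)\big)$ over all induced subgraphs $H$ of $G$; the chromatic discrepancy is $\varphi(G)=\min_\sigma \varphi_\sigma(G)$ over all proper colourings $\sigma$ of $G$. -}

module Defs where

open import Data.Nat using (ℕ; zero; suc; _+_; _≤_; _<_; _*_) renaming (_≟_ to _≟ℕ_)
open import Data.Integer using (ℤ; +_; _-_; _≥_) renaming (_+_ to _+ℤ_)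
open import Data.Fin using (Fin; zero; suc; inject₁; fromℕ)
open import Data.Fin.Subset using (Subset; _∈_; Nonempty; ⊤)
open import Data.Empty using (⊥)
open import Relation.Nullary using (¬_)
open import Data.Fin.Subset.Properties using (_∈?_)
open import Data.List using (List; length; filter; map; deduplicate; allFin)
open import Data.Bool using (Bool; true; false)
open import Data.Product using (Σ; ∃; _×_; _,_; proj₁)
open import Function.Definitions using (Injective)
open import Relation.Binary.PropositionalEquality using (_≡_; _≢_)

record Graph : Set where
  field
    n     : ℕ
    nonempty : 0 < n
    adj   : Fin n → Fin n → Bool
    sym   : ∀ i j → adj i j ≡ adj j i
    irrefl : ∀ i → adj i i ≡ false
open Graph public

Adj : (G : Graph) → Fin (n G) → Fin (n G) → Set
Adj G i j = adj G i j ≡ true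

-- G contains a cycle of length (suc k) (k ≥ 2 intended) as a (not nec. induced) subgraph:
-- an injective cyclic sequence v_0, …, v_k of vertices with consecutive ones adjacent
-- and v_k adjacent to v_0.
HasCycle : Graph → ℕ → Set
HasCycle G zero = ⊥
HasCycle G (suc k) =
  Σ (Fin (suc k) → Fin (n G)) λ f →
    Injective _≡_ _≡_ f ×
    (∀ (i : Fin k) → Adj G (f (inject₁ i)) (f (suc i))) ×
    Adj G (f (fromℕ k)) (f zero)

CycleFree : ℕ → Graph → Set
CycleFree m G = ¬ HasCycle G m

IsComplete : Graph → ℕ → Set
IsComplete G ℓ = (n G ≡ ℓ) × (∀ i j → i ≢ j → Adj G i j)

ColourableOn : (G : Graph) → Subset (n G) → ℕ → Set
ColourableOn G S k =
  Σ (Fin (n G) → Fin k) λ c →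
    ∀ i j → i ∈ S → j ∈ S → Adj G i j → c i ≢ c j

IsChromaticNumberOn : (G : Graph) → Subset (n G) → ℕ → Set
IsChromaticNumberOn G S k = ColourableOn G S k × (∀ m → ColourableOn G S m → k ≤ m)

full : (G : Graph) → Subset (n G)
full G = ⊤

IsChromaticNumber : Graph → ℕ → Set
IsChromaticNumber G k = IsChromaticNumberOn G (full G) k

ProperColouring : Graph → Set
ProperColouring G =
  Σ (Fin (n G) → ℕ) λ σ → ∀ i j → Adj G i j → σ i ≢ σ j

coloursUsed : (G : Graph) → (Fin (n G) → ℕ) → Subset (n G) → ℕ
coloursUsed G σ S = length (deduplicate _≟ℕ_ (map σ (filter (_∈? S) (allFin (n G)))))

-- φ_σ(G) ≥ t : the maximum over non-empty induced subgraphs H = G[S] of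
-- |σ(V(H))| - χ(H) is at least t, i.e. some H attains a value ≥ t.
ColouringDiscrepancyAtLeast : (G : Graph) → (Fin (n G) → ℕ) → ℤ → Set
ColouringDiscrepancyAtLeast G σ t =
  Σ (Subset (n G)) λ S → Nonempty S ×
    Σ ℕ λ χH → IsChromaticNumberOn G S χH ×
      ((+ coloursUsed G σ S) - (+ χH) ≥ t)

-- φ(G) ≥ t : the minimum over proper colourings σ of φ_σ(G) is at least t,
-- i.e. every proper colouring σ has φ_σ(G) ≥ t.
DiscrepancyAtLeast : Graph → ℤ → Set
DiscrepancyAtLeast G t = ∀ (σ : ProperColouring G) → ColouringDiscrepancyAtLeast G (proj₁ σ) t

{-# OPTIONS --safe #-}
module Submission where

-- It suffices to find a rainbow set of t vertices that is b-colourable with t - b ≥ χ - ℓ + 1. A single vertex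
-- does if χ < ℓ, so let χ ≥ ℓ.
--
-- If σ uses exactly χ colours, every colour class contains a vertex v whose neighbours carry all other colours.
-- Unless G = K_χ, we can choose a class with a further vertex y. Let L be a rainbow set of neighbours of v, one of
-- each colour other than σ(v). Then L + y is rainbow, and it is (ℓ-1)-colourable because every F ⊆ L + y has a vertex
-- of degree at most ℓ - 2 in F. Otherwise a path in F - y grows to exactly ℓ - 1 vertices a₁ a₂ … (one more vertex
-- would close a cycle C_{ℓ+1} through v), so that a₁ is adjacent to y and to all aᵢ. Exchanging a₁ and a₂ gives
-- another such path, so a₂ is adjacent to y, and v a₁ y a₂ a₃ … is a cycle C_{ℓ+1}.
--
-- If σ uses more than χ colours, the Gallai–Roy theorem gives a rainbow path with χ vertices, and there is a
-- vertex x of a further colour. Here χ + 1 ≤ 2ℓ, and in a path with at most 2ℓ vertices, colouring by position modulo ℓ is proper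
-- because a conflict is a chord closing a cycle C_{ℓ+1}. Either x extends the path or it fits into one of these
-- colour classes, so χ + 1 rainbow vertices are ℓ-colourable.

open import Defs
open import Data.Nat using (ℕ; zero; suc; _≤_; _<_; _*_; _+_; _∸_; _^_; z≤n; s≤s; _≤?_; _<?_) renaming (_≟_ to _≟ℕ_)
open import Data.Nat.Properties hiding (_≟_)
import Data.Nat.Tactic.RingSolver as ℕSolver
open import Data.Integer using (+_; _-_; +≤+) renaming (_+_ to _+ℤ_; -_ to -ℤ_; _≤_ to _≤ℤ_)
import Data.Integer.Properties as ℤ
open import Data.Integer.Tactic.RingSolver using (solve-∀)
open import Data.Bool using (true)
import Data.Bool.Properties as Bool
open import Data.Fin using (Fin; zero; suc; toℕ; fromℕ; fromℕ<; inject₁; inject≤; punchOut; finToFun; funToFin; _≟_)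
import Data.Fin as Fin
import Data.Fin.Properties as Fin
open import Data.Fin.Subset using (Subset) renaming (_∈_ to _∈ₛ_)
open import Data.Fin.Subset.Properties using (_∈?_)
open import Data.List using (List; []; _∷_; length; filter; map; deduplicate; allFin; lookup; tabulate; applyUpTo)
open import Data.List.Properties using (length-map; length-tabulate; length-applyUpTo; filter-notAll)
open import Data.List.Membership.Propositional using (_∈_; _∉_; find; lose)
open import Data.List.Membership.Propositional.Properties
  using (∈-lookup; ∈-filter⁺; ∈-filter⁻; ∈-map⁺; ∈-map⁻; ∈-allFin; ∈-deduplicate⁺; ∈-deduplicate⁻;
        ∈-tabulate⁺; ∈-tabulate⁻; ∈-applyUpTo⁺)
import Data.List.Membership.DecPropositional as DecMembership
open import Data.List.Relation.Unary.All as All using (All; []; _∷_)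
open import Data.List.Relation.Unary.All.Properties using (¬All⇒Any¬; ¬Any⇒All¬)
open import Data.List.Relation.Unary.Any as Any using (here; there)
open import Data.List.Relation.Unary.Any.Properties using (lookup-index)
open import Data.List.Relation.Unary.AllPairs using ([]; _∷_)
open import Data.List.Relation.Unary.Linked using (Linked; [-]; _∷_)
open import Data.List.Relation.Unary.Unique.Propositional using (Unique)
import Data.List.Relation.Unary.Unique.Propositional.Properties as Unique
import Data.List.Relation.Unary.Unique.DecPropositional.Properties as UniqueDec
import Data.Vec as Vec
open import Data.Vec.Properties using (lookup∘tabulate; lookup⇒[]=; []=⇒lookup)
open import Data.Product using (Σ; ∃; _×_; _,_; proj₁; proj₂)
open import Data.Sum using (_⊎_; inj₁; inj₂)
open import Data.Empty using (⊥; ⊥-elim)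
open import Data.Unit using () renaming (⊤ to Unit)
open import Function using (_∘_; id)
open import Function.Definitions using (Injective)
open import Relation.Nullary using (¬_; Dec; yes; no; does; contradiction)
open import Relation.Nullary.Decidable using (¬?; _×-dec_; _→-dec_; map′; decidable-stable; dec-true)
open import Relation.Unary using (Decidable)
open import Relation.Binary.Definitions using (DecidableEquality; tri<; tri≈; tri>)
open import Relation.Binary.PropositionalEquality as ≡
  using (_≡_; _≢_; refl; cong; subst; subst₂; trans)

-- Pigeonhole, minima and arithmetic

lookup-injective : ∀ {A : Set} {xs : List A} → Unique xs → Injective _≡_ _≡_ (lookup xs)
lookup-injective {xs = x ∷ xs} (_ ∷ _) {zero} {zero} _ = refl
lookup-injective {xs = x ∷ xs} (x∉ ∷ _) {zero} {suc j} eq = contradiction eq (All.lookup x∉ (∈-lookup j))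
lookup-injective {xs = x ∷ xs} (x∉ ∷ _) {suc i} {zero} eq = contradiction (≡.sym eq) (All.lookup x∉ (∈-lookup i))
lookup-injective {xs = x ∷ xs} (_ ∷ u) {suc i} {suc j} eq = cong suc (lookup-injective u eq)

injection⇒≤length : ∀ {A : Set} {t} {g : Fin t → A} {ys : List A} →
  Injective _≡_ _≡_ g → (∀ i → g i ∈ ys) → t ≤ length ys
injection⇒≤length {g = g} {ys} inj g∈ys = Fin.injective⇒≤ {f = λ i → Any.index (g∈ys i)} λ {i} {j} eq →
  inj (trans (lookup-index (g∈ys i)) (trans (cong (lookup ys) eq) (≡.sym (lookup-index (g∈ys j)))))

module _ {A : Set} (_≟A_ : DecidableEquality A) where
  open DecMembership _≟A_ using () renaming (_∈?_ to _∈ₗ?_)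

  longer⇒∃∉ : ∀ {xs zs : List A} → Unique xs → length zs < length xs → ∃ λ x → x ∈ xs × x ∉ zs
  longer⇒∃∉ {xs} {zs} u zs<xs with All.all? (_∈ₗ? zs) xs
  ... | no ¬all = find (¬All⇒Any¬ (_∈ₗ? zs) xs ¬all)
  ... | yes all = contradiction
    (injection⇒≤length (lookup-injective u) (λ i → All.lookup all (∈-lookup i))) (<⇒≱ zs<xs)

least : ∀ {P : ℕ → Set} → Decidable P → ∀ b → P b → ∃ λ k → P k × k ≤ b × (∀ m → P m → k ≤ m)
least P? zero Pb = 0 , Pb , z≤n , λ _ _ → z≤n
least {P} P? (suc b) Pb with P? 0
... | yes P0 = 0 , P0 , z≤n , λ _ _ → z≤n
... | no ¬P0 with k , Pk , k≤b , min ← least (P? ∘ suc) b Pb =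
  suc k , Pk , s≤s k≤b , λ { zero P0 → contradiction P0 ¬P0 ; (suc m) Pm → s≤s (min m Pm) }

-- Renumbers the colours that occur as `Fin m`, so that `m` can be compared with χ and every colour
-- has a vertex.
surjective-normalisation : ∀ {n} (σ : Fin n → ℕ) → ∃ λ m → Σ (Fin n → Fin m) λ τ →
  (∀ i → ∃ λ v → τ v ≡ i) × (∀ {v w} → σ v ≡ σ w → τ v ≡ τ w) × (∀ {v w} → τ v ≡ τ w → σ v ≡ σ w)
surjective-normalisation {n} σ = length cs , τ , onto , to , from
  where
  cs = deduplicate _≟ℕ_ (map σ (allFin n))
  σ∈ : ∀ v → σ v ∈ cs
  σ∈ v = ∈-deduplicate⁺ _≟ℕ_ (∈-map⁺ σ (∈-allFin v))
  τ : Fin n → Fin (length cs)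
  τ v = Any.index (σ∈ v)
  σ≡ : ∀ v → σ v ≡ lookup cs (τ v)
  σ≡ v = lookup-index (σ∈ v)
  cs! : Unique cs
  cs! = UniqueDec.deduplicate-! _≟ℕ_ (map σ (allFin n))
  to : ∀ {v w} → σ v ≡ σ w → τ v ≡ τ w
  to {v} {w} eq = lookup-injective cs! (trans (≡.sym (σ≡ v)) (trans eq (σ≡ w)))
  from : ∀ {v w} → τ v ≡ τ w → σ v ≡ σ w
  from {v} {w} eq = trans (σ≡ v) (trans (cong (lookup cs) eq) (≡.sym (σ≡ w)))
  onto : ∀ i → ∃ λ v → τ v ≡ i
  onto i with v , _ , eq ← ∈-map⁻ σ (∈-deduplicate⁻ _≟ℕ_ (map σ (allFin n)) (∈-lookup i)) =
    v , lookup-injective cs! (trans (≡.sym (σ≡ v)) (≡.sym eq))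

difference-≤ : ∀ {χ ℓ c h} → χ + 1 + h ≤ c + ℓ → (+ χ) - (+ ℓ) +ℤ (+ 1) ≤ℤ (+ c) - (+ h)
difference-≤ {χ} {ℓ} {c} {h} le = subst₂ _≤ℤ_ (eq₁ (+ χ) (+ ℓ) (+ h)) (eq₂ (+ c) (+ ℓ) (+ h))
  (ℤ.+-monoˡ-≤ (-ℤ (+ ℓ +ℤ + h)) (+≤+ le))
  where
  eq₁ : ∀ a b d → (a +ℤ + 1 +ℤ d) +ℤ (-ℤ (b +ℤ d)) ≡ a - b +ℤ + 1
  eq₁ = solve-∀
  eq₂ : ∀ a b d → (a +ℤ b) +ℤ (-ℤ (b +ℤ d)) ≡ a - d
  eq₂ = solve-∀

-- The bound on χ enters in this form: 5ℓ + 2 ≤ 6ℓ once ℓ ≥ 2. It leaves room for χ + 1 positions in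
-- two blocks of length ℓ.
χ<ℓ+ℓ : ∀ {ℓ χ} → 2 ≤ ℓ → 3 * χ < 5 * ℓ + 2 → χ < ℓ + ℓ
χ<ℓ+ℓ {ℓ} {χ} 2≤ℓ χ< = *-cancelˡ-< 3 χ (ℓ + ℓ)
  (<-≤-trans χ< (≤-trans (+-monoʳ-≤ (5 * ℓ) 2≤ℓ) (≤-reflexive (eq ℓ))))
  where
  eq : ∀ a → 5 * a + a ≡ 3 * (a + a)
  eq = ℕSolver.solve-∀

-- Decidable colourability and discrepancy witnesses

module _ (G : Graph) where

  private V = Fin (n G)

  Adj-sym : ∀ {v w} → Adj G v w → Adj G w v
  Adj-sym {v} {w} vw = trans (sym G w v) vw

  Adj⇒≢ : ∀ {v w} → Adj G v w → v ≢ w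
  Adj⇒≢ {v} vv refl with trans (≡.sym vv) (irrefl G v)
  ... | ()

  adj? : ∀ v w → Dec (Adj G v w)
  adj? v w = adj G v w Bool.≟ true

  colourable? : ∀ S k → Dec (ColourableOn G S k)
  colourable? S k = map′
    (λ (c , proper) → finToFun c , proper)
    (λ (c , proper) → funToFin c , λ i j i∈ j∈ ij eq → proper i j i∈ j∈ ij
      (trans (≡.sym (Fin.finToFun-funToFin c i)) (trans eq (Fin.finToFun-funToFin c j))))
    (Fin.any? {n = k ^ n G} λ c → Fin.all? λ i → Fin.all? λ j →
      (i ∈? S) →-dec ((j ∈? S) →-dec (adj? i j →-dec ¬? (finToFun c i ≟ finToFun c j))))

  image : ∀ {t} → (Fin t → V) → Subset (n G)
  image f = Vec.tabulate λ w → does (Fin.any? λ i → f i ≟ w)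

  ∈-image⁺ : ∀ {t} (f : Fin t → V) i → f i ∈ₛ image f
  ∈-image⁺ f i = lookup⇒[]= (f i) (image f)
    (trans (lookup∘tabulate _ (f i)) (dec-true (Fin.any? λ j → f j ≟ f i) (i , refl)))

  ∈-image⁻ : ∀ {t} (f : Fin t → V) {w} → w ∈ₛ image f → ∃ λ i → f i ≡ w
  ∈-image⁻ f {w} w∈
    with Fin.any? (λ i → f i ≟ w)
       | trans (≡.sym (lookup∘tabulate (λ w → does (Fin.any? λ i → f i ≟ w)) w)) ([]=⇒lookup w∈)
  ... | yes p | _ = p
  ... | no _ | ()

  colourable-image : ∀ {t b} (f : Fin t → V) → Injective _≡_ _≡_ f →
    (d : Fin t → Fin (suc b)) → (∀ i j → Adj G (f i) (f j) → d i ≢ d j) → ColourableOn G (image f) (suc b)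
  colourable-image {t} {b} f inj d proper = c , c-proper
    where
    colourAt : ∀ {w} → Dec (∃ λ i → f i ≡ w) → Fin (suc b)
    colourAt (yes (i , _)) = d i
    -- Default colour off the image, where properness is not asked; it exists because there are
    -- `suc b` colours.
    colourAt (no _) = zero
    c : V → Fin (suc b)
    c w = colourAt (Fin.any? λ i → f i ≟ w)
    c∘f : ∀ i → c (f i) ≡ d i
    c∘f i with Fin.any? (λ j → f j ≟ f i)
    ... | yes (j , eq) = cong d (inj eq)
    ... | no none = contradiction (i , refl) none
    c-proper : ∀ v w → v ∈ₛ image f → w ∈ₛ image f → Adj G v w → c v ≢ c w
    c-proper v w v∈ w∈ vw eq with ∈-image⁻ f v∈ | ∈-image⁻ f w∈
    ... | i , refl | j , refl = proper i j vw (trans (≡.sym (c∘f i)) (trans eq (c∘f j)))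

  -- A witness comes with its exact chromatic number, so `least` searches below the bound `suc b`.
  -- The last hypothesis is `suc t` - `suc b` ≥ χ - ℓ + 1 with the subtractions cleared.
  rainbow-witness : ∀ {χ ℓ t b} (σ : V → ℕ) (f : Fin (suc t) → V) → Injective _≡_ _≡_ (σ ∘ f) →
    (d : Fin (suc t) → Fin (suc b)) → (∀ i j → Adj G (f i) (f j) → d i ≢ d j) →
    χ + 1 + suc b ≤ suc t + ℓ → ColouringDiscrepancyAtLeast G σ ((+ χ) - (+ ℓ) +ℤ (+ 1))
  rainbow-witness {χ} {ℓ} {t} {b} σ f inj d proper le
    with h , colourable , h≤b , min ← least (colourable? (image f)) (suc b)
      (colourable-image f (inj ∘ cong σ) d proper)
    = image f , (f zero , ∈-image⁺ f zero) , h , (colourable , min) ,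
      difference-≤ {χ} {ℓ} (≤-trans (+-monoʳ-≤ (χ + 1) h≤b) (≤-trans le (+-monoˡ-≤ ℓ colours)))
    where
    colours : suc t ≤ coloursUsed G σ (image f)
    colours = injection⇒≤length {g = σ ∘ f} inj λ i →
      ∈-deduplicate⁺ _≟ℕ_ (∈-map⁺ σ (∈-filter⁺ (_∈? image f) (∈-allFin (f i)) (∈-image⁺ f i)))

  -- Greedy colouring of degenerate vertex sets

  nbrs : V → List V → List V
  nbrs v = filter (adj? v)

  -- Delete a vertex of degree at most `k`, colour the rest, and give the vertex a colour absent
  -- from its neighbours. The hypothesis speaks of all non-empty subsets so that it passes to the
  -- rest.
  greedy-colouring : ∀ k F → Unique F →
    (∀ F′ → Unique F′ → (∀ {w} → w ∈ F′ → w ∈ F) → (∃ λ x → x ∈ F′) →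
      ∃ λ x → x ∈ F′ × length (nbrs x F′) < suc k) →
    Σ (V → Fin (suc k)) λ c → ∀ {u w} → u ∈ F → w ∈ F → Adj G u w → c u ≢ c w
  greedy-colouring k F = go (length F) F ≤-refl
    where
    go : ∀ N F → length F ≤ N → Unique F →
      (∀ F′ → Unique F′ → (∀ {w} → w ∈ F′ → w ∈ F) → (∃ λ x → x ∈ F′) →
        ∃ λ x → x ∈ F′ × length (nbrs x F′) < suc k) →
      Σ (V → Fin (suc k)) λ c → ∀ {u w} → u ∈ F → w ∈ F → Adj G u w → c u ≢ c w
    go N [] _ _ _ = (λ _ → zero) , λ ()
    go (suc N) F@(_ ∷ _) F≤N F! low
      with x , x∈F , deg<k ← low F F! id (_ , here refl)
      with c , c-proper ← go N (filter (λ w → ¬? (w ≟ x)) F)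
             (≤-pred (≤-trans (filter-notAll (λ w → ¬? (w ≟ x)) F (lose x∈F λ x≢x → x≢x refl)) F≤N))
             (Unique.filter⁺ (λ w → ¬? (w ≟ x)) F!)
             (λ F′ F′! F′⊆ → low F′ F′! (proj₁ ∘ ∈-filter⁻ (λ w → ¬? (w ≟ x)) ∘ F′⊆))
      with a , _ , a∉ ← longer⇒∃∉ _≟_ {zs = map c (nbrs x F)} (Unique.allFin⁺ (suc k))
             (subst₂ _<_ (≡.sym (length-map c (nbrs x F))) (≡.sym (length-tabulate {n = suc k} id)) deg<k)
      = recolour , proper
      where
      recolour : V → Fin (suc k)
      recolour w with w ≟ x
      ... | yes _ = a
      ... | no _ = c w
      fresh : ∀ {w} → w ∈ F → Adj G x w → a ≢ c w
      fresh w∈F xw refl = a∉ (∈-map⁺ c (∈-filter⁺ (adj? x) w∈F xw))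
      proper : ∀ {u w} → u ∈ F → w ∈ F → Adj G u w → recolour u ≢ recolour w
      proper {u} {w} u∈F w∈F uw with u ≟ x | w ≟ x
      ... | yes refl | yes refl = contradiction refl (Adj⇒≢ uw)
      ... | yes refl | no _ = fresh w∈F uw
      ... | no _ | yes refl = fresh u∈F (Adj-sym uw) ∘ ≡.sym
      ... | no u≢x | no w≢x = c-proper (∈-filter⁺ (λ z → ¬? (z ≟ x)) u∈F u≢x) (∈-filter⁺ (λ z → ¬? (z ≟ x)) w∈F w≢x) uw

  -- Neighbours of a vertex together with one further vertex

  final : V → List V → V
  final v [] = v
  final v (w ∷ ws) = final w ws

  final-∈ : ∀ v ws → final v ws ∈ v ∷ ws
  final-∈ v [] = here refl
  final-∈ v (w ∷ ws) = there (final-∈ w ws)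

  listCycle : ∀ k v ws → length ws ≡ k → Linked (Adj G) (v ∷ ws) → Unique (v ∷ ws) → Adj G (final v ws) v →
    HasCycle G (suc k)
  listCycle _ v ws refl link unique closed = lookup (v ∷ ws) , lookup-injective unique , steps v ws link ,
    subst (λ w → Adj G w v) (≡.sym (end v ws)) closed
    where
    steps : ∀ v ws → Linked (Adj G) (v ∷ ws) → ∀ i → Adj G (lookup (v ∷ ws) (inject₁ i)) (lookup ws i)
    steps v (w ∷ ws) (vw ∷ _) zero = vw
    steps v (w ∷ ws) (_ ∷ link) (suc i) = steps w ws link i
    end : ∀ v ws → lookup (v ∷ ws) (fromℕ (length ws)) ≡ final v ws
    end v [] = refl
    end v (w ∷ ws) = end w ws

  module _ (q : ℕ) (acyclic : CycleFree (4 + q) G) {v y : V} (y≢v : y ≢ v) where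

    -- Here ℓ = 3 + q. On failure every vertex of `F` has at least ℓ - 1 neighbours in `F`, enough
    -- to grow paths through neighbours of `v` until they force a cycle of length ℓ + 1.
    low-degree : ∀ F → Unique F → (∀ {w} → w ∈ F → w ≡ y ⊎ Adj G v w) → (∃ λ x → x ∈ F) →
      ∃ λ x → x ∈ F × length (nbrs x F) < 2 + q
    low-degree F F! F⊆ (x₀ , x₀∈F) with Any.any? (λ x → length (nbrs x F) <? 2 + q) F
    ... | yes some = find some
    ... | no none = ⊥-elim contra
      where
      open DecMembership (_≟_ {n G}) using () renaming (_∈?_ to _∈ₗ?_)

      another : ∀ {x} zs → x ∈ F → length zs < 2 + q → ∃ λ w → w ∈ F × Adj G x w × w ∉ zs
      another {x} zs x∈F zs< with w , w∈ , w∉ ← longer⇒∃∉ _≟_ (Unique.filter⁺ (adj? x) F!)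
             (<-≤-trans zs< (≮⇒≥ λ deg< → none (lose x∈F deg<)))
        with w∈F , xw ← ∈-filter⁻ (adj? x) w∈ = w , w∈F , xw , w∉

      InF-y : V → Set
      InF-y w = w ∈ F × w ≢ y

      Path : List V → Set
      Path xs = Linked (Adj G) xs × Unique xs × All InF-y xs

      v~ : ∀ {w} → InF-y w → Adj G v w
      v~ (w∈F , w≢y) with F⊆ w∈F
      ... | inj₁ w≡y = contradiction w≡y w≢y
      ... | inj₂ vw = vw

      avoids-v : ∀ {xs} → All InF-y xs → All (v ≢_) xs
      avoids-v = All.map (Adj⇒≢ ∘ v~)

      extend : ∀ {w a xs} → w ∈ F → w ≢ y → Adj G a w → w ∉ xs → Path (a ∷ xs) → Path (w ∷ a ∷ xs)
      extend w∈F w≢y aw w∉xs (link , unique , inF) =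
        Adj-sym aw ∷ link , ((Adj⇒≢ (Adj-sym aw) ∷ ¬Any⇒All¬ _ w∉xs) ∷ unique) , (w∈F , w≢y) ∷ inF

      tooLong : ∀ {a xs} → length xs ≡ 2 + q → ¬ Path (a ∷ xs)
      tooLong {a} {xs} len (link , unique , inF) =
        acyclic (listCycle (3 + q) v (a ∷ xs) (cong suc len) (v~ (All.head inF) ∷ link) (avoids-v inF ∷ unique)
          (Adj-sym (v~ (All.lookup inF (final-∈ a xs)))))

      start : ∃ λ a → InF-y a
      start with x₀ ≟ y
      ... | no x₀≢y = x₀ , x₀∈F , x₀≢y
      ... | yes refl with w , w∈F , yw , _ ← another [] x₀∈F (s≤s z≤n) = w , w∈F , Adj⇒≢ yw ∘ ≡.sym

      -- `y` and the entries behind the head are fewer than ℓ - 1 exclusions at each extension, so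
      -- the path can reach ℓ - 1 vertices.
      grow : ∀ j → j ≤ suc q → ∃ λ a → ∃ λ xs → length xs ≡ j × Path (a ∷ xs)
      grow zero _ with a , inF ← start = a , [] , refl , [-] , ([] ∷ []) , (inF ∷ [])
      grow (suc j) j<
        with a , xs , refl , path@(_ , _ , (a∈F , _) ∷ _) ← grow j (<⇒≤ j<)
        with w , w∈F , aw , w∉ ← another (y ∷ xs) a∈F (s≤s j<)
        = w , a ∷ xs , refl , extend w∈F (w∉ ∘ here) aw (w∉ ∘ there) path

      -- `a` has at least ℓ - 1 neighbours in `F`, but only ℓ - 2 entries follow it; a further
      -- neighbour other than `y` would lengthen the path to ℓ vertices.
      y~start : ∀ {a xs} → length xs ≡ suc q → Path (a ∷ xs) → Adj G a y
      y~start {a} {xs} len path@(_ , _ , (a∈F , _) ∷ _)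
        with w , w∈F , aw , w∉xs ← another xs a∈F (s≤s (≤-reflexive len))
        with w ≟ y
      ... | yes refl = aw
      ... | no w≢y = ⊥-elim (tooLong (cong suc len) (extend w∈F w≢y aw w∉xs path))

      -- With `y` and all entries behind `a` except `c` excluded, `a` still has a neighbour; any but
      -- `c` would lengthen the path. `swap` needs this chord.
      start~third : ∀ {a b c rest} → length (b ∷ c ∷ rest) ≡ suc q → Path (a ∷ b ∷ c ∷ rest) → Adj G a c
      start~third {a} {b} {c} {rest} len path@(_ , _ , (a∈F , _) ∷ _)
        with w , w∈F , aw , w∉ ← another (y ∷ b ∷ rest) a∈F (s≤s (≤-reflexive len))
        with w ≟ c
      ... | yes refl = aw
      ... | no w≢c = ⊥-elim (tooLong (cong suc len) (extend w∈F (w∉ ∘ here) aw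
            (λ { (here w≡b) → w∉ (there (here w≡b))
               ; (there (here w≡c)) → w≢c w≡c
               ; (there (there w∈)) → w∉ (there (there w∈)) }) path))

      swap : ∀ {a b rest} → length (b ∷ rest) ≡ suc q → Path (a ∷ b ∷ rest) → Path (b ∷ a ∷ rest)
      swap {rest = []} _ (ab ∷ _ , ((a≢b ∷ []) ∷ _) , inFa ∷ inFb ∷ []) =
        Adj-sym ab ∷ [-] , ((a≢b ∘ ≡.sym ∷ []) ∷ [] ∷ []) , inFb ∷ inFa ∷ []
      swap {rest = _ ∷ _} len path@(ab ∷ _ ∷ link , ((a≢b ∷ a≢) ∷ b≢ ∷ u) , inFa ∷ inFb ∷ inF) =
        Adj-sym ab ∷ start~third len path ∷ link , ((a≢b ∘ ≡.sym ∷ b≢) ∷ a≢ ∷ u) , inFb ∷ inFa ∷ inF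

      contra : ⊥
      contra with grow (suc q) ≤-refl
      ... | a , b ∷ rest , len , path@(ab ∷ link , ((a≢b ∷ a≢) ∷ u) , inFa ∷ inF) =
        -- The path has ℓ - 1 vertices, and `v` and `y` make ℓ + 1. The edge from `y` to `b` comes
        -- from the path with `a` and `b` exchanged.
        acyclic (listCycle (3 + q) v (a ∷ y ∷ b ∷ rest) (cong suc (cong suc len))
          (v~ inFa ∷ y~start len path ∷ Adj-sym (y~start len (swap len path)) ∷ link)
          ((Adj⇒≢ (v~ inFa) ∷ y≢v ∘ ≡.sym ∷ avoids-v inF) ∷ (proj₂ inFa ∷ a≢b ∷ a≢)
            ∷ All.map (λ (_ , w≢y) → w≢y ∘ ≡.sym) inF ∷ u)
          (Adj-sym (v~ (All.lookup inF (final-∈ b rest)))))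

    colour-nbrs-and-one : ∀ F → Unique F → (∀ {w} → w ∈ F → w ≡ y ⊎ Adj G v w) →
      Σ (V → Fin (2 + q)) λ c → ∀ {u w} → u ∈ F → w ∈ F → Adj G u w → c u ≢ c w
    colour-nbrs-and-one F F! F⊆ = greedy-colouring (suc q) F F! λ F′ F′! F′⊆F → low-degree F′ F′! (F⊆ ∘ F′⊆F)

  -- Rainbow centres and colourings with exactly χ colours

  -- Known as a b-vertex in the theory of b-colourings.
  RainbowCentre : ∀ {m} → (V → Fin m) → V → Set
  RainbowCentre τ v = ∀ d → d ≢ τ v → ∃ λ w → Adj G v w × τ w ≡ d

  rainbowCentre? : ∀ {m} (τ : V → Fin m) → Decidable (RainbowCentre τ)
  rainbowCentre? τ v = Fin.all? λ d → ¬? (d ≟ τ v) →-dec Fin.any? λ w → adj? v w ×-dec (τ w ≟ d)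

  -- A class without a rainbow centre can be dissolved, each of its vertices moving to a colour it does not see.
  rainbowCentre-exists : ∀ {m} (τ : V → Fin (suc m)) → (∀ {v w} → Adj G v w → τ v ≢ τ w) →
    (∀ k → ColourableOn G (full G) k → suc m ≤ k) → ∀ c → ∃ λ v → τ v ≡ c × RainbowCentre τ v
  rainbowCentre-exists {m} τ proper χ≥ c with Fin.any? (λ v → (τ v ≟ c) ×-dec rainbowCentre? τ v)
  ... | yes found = found
  ... | no none = contradiction (χ≥ m (c′ , λ i j _ _ ij eq →
      moved-proper ij (Fin.punchOut-injective (c≢moved i) (c≢moved j) eq))) 1+n≰n
    where
    unseen : ∀ v → τ v ≡ c → ∃ λ d → d ≢ τ v × ∀ w → Adj G v w → τ w ≢ d
    unseen v eq with d , ¬seen ← Fin.¬∀⟶∃¬ _ _ (λ d → ¬? (d ≟ τ v) →-dec Fin.any? λ w → adj? v w ×-dec (τ w ≟ d))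
                       (λ centre → none (v , eq , centre)) =
      d , (λ d≡ → ¬seen λ d≢ → contradiction d≡ d≢) , λ w vw τw≡d → ¬seen λ _ → w , vw , τw≡d
    moved : ∀ v → Σ (Fin (suc m)) λ d → c ≢ d × (τ v ≢ c → d ≡ τ v) × (τ v ≡ c → ∀ w → Adj G v w → τ w ≢ d)
    moved v with τ v ≟ c
    ... | no ≢c = τ v , ≢c ∘ ≡.sym , (λ _ → refl) , λ ≡c → contradiction ≡c ≢c
    ... | yes refl with d , d≢ , avoid ← unseen v refl = d , d≢ ∘ ≡.sym , contradiction refl , λ _ → avoid
    moved-proper : ∀ {v w} → Adj G v w → proj₁ (moved v) ≢ proj₁ (moved w)
    moved-proper {v} {w} vw eq
      with dv , _ , keepv , avoidv ← moved v | dw , _ , keepw , avoidw ← moved w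
      with τ v ≟ c | τ w ≟ c
    -- Class `c` is independent, so at most one end of an edge moves.
    ... | yes v≡ | yes w≡ = proper vw (trans v≡ (≡.sym w≡))
    ... | yes v≡ | no w≢ = avoidv v≡ w vw (≡.sym (trans eq (keepw w≢)))
    ... | no v≢ | yes w≡ = avoidw w≡ v (Adj-sym vw) (trans (≡.sym (keepv v≢)) eq)
    ... | no v≢ | no w≢ = proper vw (trans (≡.sym (keepv v≢)) (trans eq (keepw w≢)))
    c≢moved : ∀ v → c ≢ proj₁ (moved v)
    c≢moved v = proj₁ (proj₂ (moved v))
    c′ : V → Fin m
    c′ v = punchOut (c≢moved v)

  -- Common outcome of the cases of exactly χ and of more than χ colours, in the shape that
  -- `rainbow-witness` takes.
  RainbowColoured : ∀ {m} → (V → Fin m) → ℕ → ℕ → Set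
  RainbowColoured τ t b = Σ (Fin t → V) λ f → Injective _≡_ _≡_ (τ ∘ f) ×
    Σ (Fin t → Fin b) λ d → ∀ i j → Adj G (f i) (f j) → d i ≢ d j

  complete⇒cycle : ∀ {k} → k < n G → 0 < k → (∀ i j → i ≢ j → Adj G i j) → HasCycle G (suc k)
  complete⇒cycle {suc k} k<n _ complete = f , f-inj ,
    (λ i → complete _ _ λ eq → 1+n≢n (≡.sym (trans (≡.sym (Fin.toℕ-inject₁ i)) (cong toℕ (f-inj eq))))) ,
    complete _ _ λ eq → Fin.0≢1+n (≡.sym (f-inj eq))
    where
    f : Fin (2 + k) → V
    f i = inject≤ i k<n
    f-inj : Injective _≡_ _≡_ f
    f-inj = Fin.inject≤-injective _ _ _ _

  -- A class with two vertices has a rainbow centre `v` and a second vertex `y`. If all classes are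
  -- singletons, every vertex is a rainbow centre, so the graph is complete on at least ℓ vertices;
  -- exactly ℓ is excluded, and more give a cycle of length ℓ + 1.
  optimal-colouring : ∀ q m → CycleFree (4 + q) G → ¬ IsComplete G (3 + q) → 3 + q ≤ suc m →
    (τ : V → Fin (suc m)) → (∀ i → ∃ λ v → τ v ≡ i) → (∀ {v w} → Adj G v w → τ v ≢ τ w) →
    (∀ k → ColourableOn G (full G) k → suc m ≤ k) → RainbowColoured τ (suc m) (2 + q)
  optimal-colouring q m acyclic incomplete ℓ≤χ τ onto proper χ≥
    with Fin.any? (λ v → Fin.any? λ w → ¬? (v ≟ w) ×-dec (τ v ≟ τ w))
  ... | yes (v₁ , v₂ , v₁≢v₂ , same) = f , f-inj , d , d-proper
    where
    centre = rainbowCentre-exists τ proper χ≥ (τ v₁)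
    v = proj₁ centre
    other : ∃ λ y → y ≢ v × τ y ≡ τ v
    other with v ≟ v₁
    ... | yes eq = v₂ , (λ v₂≡v → v₁≢v₂ (≡.sym (trans v₂≡v eq))) , trans (≡.sym same) (cong τ (≡.sym eq))
    ... | no v≢v₁ = v₁ , v≢v₁ ∘ ≡.sym , ≡.sym (proj₁ (proj₂ centre))
    y = proj₁ other
    choose : ∀ i → ∃ λ w → τ w ≡ i × (w ≡ y ⊎ Adj G v w)
    -- `y` stands in for `v` in the colour of `v`.
    choose i with i ≟ τ v
    ... | yes refl = y , proj₂ (proj₂ other) , inj₁ refl
    ... | no i≢ with w , vw , eq ← proj₂ (proj₂ centre) i i≢ = w , eq , inj₂ vw
    f : Fin (suc m) → V
    f = proj₁ ∘ choose
    f-inj : Injective _≡_ _≡_ (τ ∘ f)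
    f-inj {i} {j} eq = trans (≡.sym (proj₁ (proj₂ (choose i)))) (trans eq (proj₁ (proj₂ (choose j))))
    F = tabulate f
    F⊆ : ∀ {w} → w ∈ F → w ≡ y ⊎ Adj G v w
    F⊆ w∈ with i , refl ← ∈-tabulate⁻ {f = f} w∈ = proj₂ (proj₂ (choose i))
    coloured = colour-nbrs-and-one q acyclic (proj₁ (proj₂ other)) F (Unique.tabulate⁺ (f-inj ∘ cong τ)) F⊆
    d : Fin (suc m) → Fin (2 + q)
    d = proj₁ coloured ∘ f
    d-proper : ∀ i j → Adj G (f i) (f j) → d i ≢ d j
    d-proper i j = proj₂ coloured (∈-tabulate⁺ {f = f} i) (∈-tabulate⁺ {f = f} j)
  ... | no none = ⊥-elim (impossible (m≤n⇒m<n∨m≡n (≤-trans ℓ≤χ χ≤n)))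
    where
    τ-inj : ∀ {v w} → τ v ≡ τ w → v ≡ w
    τ-inj {v} {w} eq = decidable-stable (v ≟ w) λ v≢w → none (v , w , v≢w , eq)
    χ≤n : suc m ≤ n G
    χ≤n = Fin.injective⇒≤ {f = proj₁ ∘ onto} λ {i} {j} eq →
      trans (≡.sym (proj₂ (onto i))) (trans (cong τ eq) (proj₂ (onto j)))
    complete : ∀ i j → i ≢ j → Adj G i j
    complete i j i≢j with v , v≡ , rainbow ← rainbowCentre-exists τ proper χ≥ (τ i)
      with refl ← τ-inj v≡
      with w , iw , w≡ ← rainbow (τ j) (i≢j ∘ τ-inj ∘ ≡.sym)
      with refl ← τ-inj w≡ = iw
    impossible : 3 + q < n G ⊎ 3 + q ≡ n G → ⊥
    impossible (inj₁ ℓ<n) = acyclic (complete⇒cycle ℓ<n (s≤s z≤n) complete)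
    impossible (inj₂ ℓ≡n) = incomplete (≡.sym ℓ≡n , complete)

  -- Rainbow paths

  module _ {m} (τ : V → Fin m) (proper : ∀ {v w} → Adj G v w → τ v ≢ τ w) where

    -- Only the first `N` values of the function count, so prepending, inserting and shifting need
    -- no index conversions. Distinct colours also make the vertices distinct.
    RainbowPath : ℕ → (ℕ → V) → Set
    RainbowPath N p = (∀ i → suc i < N → Adj G (p i) (p (suc i))) ×
      (∀ {i j} → i < N → j < N → τ (p i) ≡ τ (p j) → i ≡ j)

    cons : V → (ℕ → V) → ℕ → V
    cons x p zero = x
    cons x p (suc i) = p i

    cons-rainbowPath : ∀ {N x p} → Adj G x (p 0) → (∀ i → i < N → τ x ≢ τ (p i)) →
      RainbowPath N p → RainbowPath (suc N) (cons x p)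
    cons-rainbowPath {N} {x} {p} xp fresh (path , rainbow) = path′ , rainbow′
      where
      path′ : ∀ i → suc i < suc N → Adj G (cons x p i) (p i)
      path′ zero _ = xp
      path′ (suc i) (s≤s i<) = path i i<
      rainbow′ : ∀ {i j} → i < suc N → j < suc N → τ (cons x p i) ≡ τ (cons x p j) → i ≡ j
      rainbow′ {zero} {zero} _ _ _ = refl
      rainbow′ {zero} {suc j} _ (s≤s j<) eq = contradiction eq (fresh j j<)
      rainbow′ {suc i} {zero} (s≤s i<) _ eq = contradiction (≡.sym eq) (fresh i i<)
      rainbow′ {suc i} {suc j} (s≤s i<) (s≤s j<) eq = cong suc (rainbow i< j< eq)

    tail-rainbowPath : ∀ {N p} → RainbowPath (suc N) p → RainbowPath N (p ∘ suc)
    tail-rainbowPath (path , rainbow) =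
      (λ i i< → path (suc i) (s≤s i<)) , λ i< j< eq → suc-injective (rainbow (s≤s i<) (s≤s j<) eq)

    insertAfter : ℕ → V → (ℕ → V) → ℕ → V
    insertAfter zero x p = cons (p 0) (cons x (p ∘ suc))
    insertAfter (suc a) x p = cons (p 0) (insertAfter a x (p ∘ suc))

    insertAfter-misses : ∀ {N p x c} a → a < N → τ x ≢ c → (∀ i → i < N → τ (p i) ≢ c) →
      ∀ i → i < suc N → τ (insertAfter a x p i) ≢ c
    insertAfter-misses zero a<N x≢ p≢ zero _ = p≢ 0 a<N
    insertAfter-misses zero a<N x≢ p≢ (suc zero) _ = x≢
    insertAfter-misses zero a<N x≢ p≢ (suc (suc i)) (s≤s i<) = p≢ (suc i) i<
    insertAfter-misses (suc a) a<N x≢ p≢ zero _ = p≢ 0 (≤-trans (s≤s z≤n) a<N)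
    insertAfter-misses (suc a) (s≤s a<N) x≢ p≢ (suc i) (s≤s i<) =
      insertAfter-misses a a<N x≢ (λ j j< → p≢ (suc j) (s≤s j<)) i i<

    insertAfter-rainbowPath : ∀ {N p x} a → suc a < N → Adj G x (p a) → Adj G x (p (suc a)) →
      (∀ i → i < N → τ x ≢ τ (p i)) → RainbowPath N p → RainbowPath (suc N) (insertAfter a x p)
    insertAfter-rainbowPath {suc N} {p} {x} zero a<N xp xp′ fresh rp =
      cons-rainbowPath (Adj-sym xp) p₀-fresh
        (cons-rainbowPath xp′ (λ i i< → fresh (suc i) (s≤s i<)) (tail-rainbowPath rp))
      where
      p₀-fresh : ∀ i → i < suc N → τ (p 0) ≢ τ (cons x (p ∘ suc) i)
      p₀-fresh zero _ eq = fresh 0 (s≤s z≤n) (≡.sym eq)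
      p₀-fresh (suc i) i< eq with proj₂ rp (s≤s z≤n) i< eq
      ... | ()
    insertAfter-rainbowPath {suc N} {p} {x} (suc a) (s≤s a<N) xp xp′ fresh rp =
      cons-rainbowPath (head-adj a) (λ i i< eq → insertAfter-misses a (<⇒≤ a<N)
          (fresh 0 (s≤s z≤n)) p₀-fresh i i< (≡.sym eq))
        (insertAfter-rainbowPath a a<N xp xp′ (λ i i< → fresh (suc i) (s≤s i<)) (tail-rainbowPath rp))
      where
      head-adj : ∀ a → Adj G (p 0) (insertAfter a x (p ∘ suc) 0)
      head-adj zero = proj₁ rp 0 (s≤s (≤-trans (s≤s z≤n) a<N))
      head-adj (suc a) = proj₁ rp 0 (s≤s (≤-trans (s≤s z≤n) a<N))
      p₀-fresh : ∀ i → i < N → τ (p (suc i)) ≢ τ (p 0)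
      p₀-fresh i i< eq with proj₂ rp (s≤s i<) (s≤s z≤n) eq
      ... | ()

    -- The Gallai-Roy theorem

    -- A directed path with `j` edges from `v` when each edge is oriented towards its smaller
    -- colour.
    Descent : ℕ → V → Set
    Descent zero v = Unit
    Descent (suc j) v = ∃ λ w → Adj G v w × τ w Fin.< τ v × Descent j w

    descent? : ∀ j v → Dec (Descent j v)
    descent? zero v = yes _
    descent? (suc j) v = Fin.any? λ w → adj? v w ×-dec (τ w Fin.<? τ v) ×-dec descent? j w

    -- For positive `k`, `c v` is the greatest number of edges, below `k`, of a descent from `v`.
    descentless-colouring : ∀ k → Σ (V → ℕ) λ c → (∀ {v} → ¬ Descent k v → c v < k) ×
      (∀ {v w} → ¬ Descent k v → ¬ Descent k w → Adj G v w → c v ≢ c w)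
    descentless-colouring zero = (λ _ → 0) , (λ no → contradiction _ no) , λ no → contradiction _ no
    descentless-colouring (suc k) with c , c< , c-proper ← descentless-colouring k = c′ , c′< , c′-proper
      where
      c′ : V → ℕ
      c′ v with descent? k v
      ... | yes _ = k
      ... | no _ = c v
      c′< : ∀ {v} → ¬ Descent (suc k) v → c′ v < suc k
      c′< {v} _ with descent? k v
      ... | yes _ = ≤-refl
      ... | no no′ = m<n⇒m<1+n (c< no′)
      c′-proper : ∀ {v w} → ¬ Descent (suc k) v → ¬ Descent (suc k) w → Adj G v w → c′ v ≢ c′ w
      c′-proper {v} {w} nov now vw with descent? k v | descent? k w
      ... | no nov′ | no now′ = c-proper nov′ now′ vw
      ... | yes _ | no now′ = λ eq → <⇒≢ (c< now′) (≡.sym eq)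
      ... | no nov′ | yes _ = <⇒≢ (c< nov′)
      -- Both ends start descents with `k` edges, so the end of larger colour starts one with
      -- `suc k` edges.
      ... | yes dv | yes dw with Fin.<-cmp (τ v) (τ w)
      ...   | tri< lt _ _ = contradiction (v , Adj-sym vw , lt , dv) now
      ...   | tri≈ _ eq _ = contradiction eq (proper vw)
      ...   | tri> _ _ gt = contradiction (w , vw , gt , dw) nov

    -- The bound by `τ v` is carried along so that a prepended vertex of larger colour is fresh.
    descent-path : ∀ j {v} → Descent j v → ∃ λ p → p 0 ≡ v × RainbowPath (suc j) p ×
      (∀ i → i < suc j → τ (p i) Fin.≤ τ v)
    descent-path zero {v} _ = (λ _ → v) , refl ,
      ((λ { _ (s≤s ()) }) , λ { (s≤s z≤n) (s≤s z≤n) _ → refl }) , λ _ _ → ≤-refl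
    descent-path (suc j) {v} (w , vw , w<v , dw) with p , refl , rp , p≤ ← descent-path j dw =
      cons v p , refl ,
      cons-rainbowPath vw (λ i i< eq → <⇒≢ (≤-<-trans (p≤ i i<) w<v) (cong toℕ (≡.sym eq))) rp ,
      λ { zero _ → ≤-refl ; (suc i) (s≤s i<) → ≤-trans (p≤ i i<) (<⇒≤ w<v) }

    -- Directed paths have strictly decreasing colours and hence are rainbow. With no descent of `k`
    -- edges, `k` colours would suffice.
    gallai-roy : ∀ k → (∀ b → ColourableOn G (full G) b → suc k ≤ b) → ∃ λ p → RainbowPath (suc k) p
    gallai-roy k χ≥ with Fin.any? (descent? k)
    ... | yes (v , dv) with p , _ , rp , _ ← descent-path k dv = p , rp
    ... | no none with c , c< , c-proper ← descentless-colouring k = contradiction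
      (χ≥ k ((λ v → fromℕ< (c< (no-descent v))) ,
        λ v w _ _ vw eq → c-proper (no-descent v) (no-descent w) vw (Fin.fromℕ<-injective _ _ _ _ eq)))
      1+n≰n
      where
      no-descent : ∀ v → ¬ Descent k v
      no-descent v dv = none (v , dv)

    -- Colouring a path by position modulo ℓ

    module _ (l : ℕ) (acyclic : CycleFree (2 + l) G) where

      private ℓ = suc l

      -- The chord would close the ℓ + 1 vertices from `p i` to `p (ℓ + i)` into a cycle.
      no-chord : ∀ {N p i} → RainbowPath N p → ℓ + i < N → ¬ Adj G (p i) (p (ℓ + i))
      no-chord {N} {p} {i} (path , rainbow) ℓ+i<N chord = acyclic
        ((λ j → p (toℕ j + i)) ,
         (λ {a} {b} eq → Fin.toℕ-injective (+-cancelʳ-≡ i _ _ (rainbow (bound a) (bound b) (cong τ eq)))) ,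
         (λ j → subst (λ a → Adj G (p (a + i)) (p (suc (toℕ j) + i))) (≡.sym (Fin.toℕ-inject₁ j))
           (path (toℕ j + i) (bound (suc j)))) ,
         subst (λ a → Adj G (p (a + i)) (p i)) (≡.sym (Fin.toℕ-fromℕ ℓ)) (Adj-sym chord))
        where
        bound : ∀ (j : Fin (suc ℓ)) → toℕ j + i < N
        bound j = ≤-<-trans (+-monoˡ-≤ i (≤-pred (Fin.toℕ<n j))) ℓ+i<N

      -- The residue modulo ℓ for positions below 2ℓ.
      fold : ℕ → ℕ
      fold i with i <? ℓ
      ... | yes _ = i
      ... | no _ = i ∸ ℓ

      fold-inverse : ∀ i → i ≡ fold i ⊎ i ≡ ℓ + fold i
      fold-inverse i with i <? ℓ
      ... | yes _ = inj₁ refl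
      ... | no i≮ℓ = inj₂ (≡.sym (m+[n∸m]≡n (≮⇒≥ i≮ℓ)))

      fold< : ∀ {i} → i < ℓ + ℓ → fold i < ℓ
      fold< {i} i< with i <? ℓ
      ... | yes i<ℓ = i<ℓ
      ... | no i≮ℓ = +-cancelˡ-< ℓ _ _ (subst (_< ℓ + ℓ) (≡.sym (m+[n∸m]≡n (≮⇒≥ i≮ℓ))) i<)

      -- Positions with the same `fold` are equal or differ by ℓ, and `no-chord` forbids an edge in
      -- the latter case.
      fold-proper : ∀ {N p i j} → RainbowPath N p → i < N → j < N → Adj G (p i) (p j) → fold i ≢ fold j
      fold-proper {i = i} {j} rp i<N j<N pp eq with fold-inverse i | fold-inverse j
      ... | inj₁ i≡ | inj₁ j≡ with refl ← trans i≡ (trans eq (≡.sym j≡)) = Adj⇒≢ pp refl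
      ... | inj₂ i≡ | inj₂ j≡ with refl ← trans i≡ (trans (cong (_+_ ℓ) eq) (≡.sym j≡)) = Adj⇒≢ pp refl
      ... | inj₁ i≡ | inj₂ j≡ with refl ← trans j≡ (cong (_+_ ℓ) (trans (≡.sym eq) (≡.sym i≡))) = no-chord rp j<N pp
      ... | inj₂ i≡ | inj₁ j≡ with refl ← trans i≡ (cong (_+_ ℓ) (trans eq (≡.sym j≡))) = no-chord rp i<N (Adj-sym pp)

      path-coloured : ∀ {N p} → RainbowPath N p → N ≤ ℓ + ℓ → RainbowColoured τ N ℓ
      path-coloured {N} {p} rp N≤ = p ∘ toℕ ,
        (λ {i} {j} eq → Fin.toℕ-injective (proj₂ rp (Fin.toℕ<n i) (Fin.toℕ<n j) eq)) ,
        (λ i → fromℕ< (fold< (<-≤-trans (Fin.toℕ<n i) N≤))) ,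
        λ i j pp eq → fold-proper {p = p} rp (Fin.toℕ<n i) (Fin.toℕ<n j) pp (Fin.fromℕ<-injective _ _ _ _ eq)

      path-and-vertex-coloured : ∀ {N p x a} → RainbowPath N p → N ≤ ℓ + ℓ → (∀ i → i < N → τ x ≢ τ (p i)) →
        a < ℓ → (∀ i → i < N → fold i ≡ a → ¬ Adj G x (p i)) → RainbowColoured τ (suc N) ℓ
      path-and-vertex-coloured {N} {p} {x} {a} rp N≤ fresh a<ℓ apart = f , (λ {i} {j} → f-inj i j) , d , d-proper
        where
        f : Fin (suc N) → V
        f zero = x
        f (suc i) = p (toℕ i)
        f-inj : ∀ i j → τ (f i) ≡ τ (f j) → i ≡ j
        f-inj zero zero _ = refl
        f-inj zero (suc j) eq = contradiction eq (fresh (toℕ j) (Fin.toℕ<n j))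
        f-inj (suc i) zero eq = contradiction (≡.sym eq) (fresh (toℕ i) (Fin.toℕ<n i))
        f-inj (suc i) (suc j) eq = cong suc (Fin.toℕ-injective (proj₂ rp (Fin.toℕ<n i) (Fin.toℕ<n j) eq))
        d : Fin (suc N) → Fin ℓ
        d zero = fromℕ< a<ℓ
        d (suc i) = fromℕ< (fold< (<-≤-trans (Fin.toℕ<n i) N≤))
        d-proper : ∀ i j → Adj G (f i) (f j) → d i ≢ d j
        d-proper zero zero xx _ = Adj⇒≢ xx refl
        d-proper zero (suc j) xp eq =
          apart (toℕ j) (Fin.toℕ<n j) (≡.sym (Fin.fromℕ<-injective _ _ _ _ eq)) xp
        d-proper (suc i) zero px eq =
          apart (toℕ i) (Fin.toℕ<n i) (Fin.fromℕ<-injective _ _ _ _ eq) (Adj-sym px)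
        d-proper (suc i) (suc j) pp eq =
          fold-proper {p = p} rp (Fin.toℕ<n i) (Fin.toℕ<n j) pp (Fin.fromℕ<-injective _ _ _ _ eq)

      -- If x cannot be put in front of the path nor between p (ℓ - 1) and p ℓ,
      -- it fits into the class {p 0, p ℓ} or into the class {p (ℓ - 1)}.
      path-and-fresh-coloured : ∀ {N p x} → RainbowPath N p → N < ℓ + ℓ →
        (∀ i → i < N → τ x ≢ τ (p i)) → RainbowColoured τ (suc N) ℓ
      path-and-fresh-coloured {N} {p} {x} rp N< fresh with adj? x (p 0)
      ... | yes xp₀ = path-coloured (cons-rainbowPath xp₀ fresh rp) N<
      -- The test `ℓ <? N` guards `p ℓ`, as values of `p` from `N` on are arbitrary.
      ... | no ¬xp₀ with (ℓ <? N) ×-dec adj? x (p ℓ)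
      ...   | no ¬xpₗ = path-and-vertex-coloured {a = 0} rp (<⇒≤ N<) fresh (s≤s z≤n) apart
        where
        apart : ∀ i → i < N → fold i ≡ 0 → ¬ Adj G x (p i)
        apart i i<N i≡ xp with fold-inverse i
        ... | inj₁ eq with refl ← trans eq i≡ = ¬xp₀ xp
        ... | inj₂ eq with refl ← trans eq (trans (cong (_+_ ℓ) i≡) (+-identityʳ ℓ)) = ¬xpₗ (i<N , xp)
      ...   | yes (ℓ<N , xpₗ) with adj? x (p l)
      ...     | yes xp = path-coloured (insertAfter-rainbowPath l ℓ<N xp xpₗ fresh rp) N<
      ...     | no ¬xp = path-and-vertex-coloured {a = l} rp (<⇒≤ N<) fresh ≤-refl apart
        where
        apart : ∀ i → i < N → fold i ≡ l → ¬ Adj G x (p i)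
        apart i i<N i≡ xp′ with fold-inverse i
        ... | inj₁ eq with refl ← trans eq i≡ = ¬xp xp′
        -- Position 2ℓ - 1 lies off the path because N < 2ℓ.
        ... | inj₂ eq with refl ← trans eq (cong (_+_ ℓ) i≡) =
          <⇒≱ N< (subst (_≤ N) (≡.sym (+-suc ℓ l)) i<N)

      suboptimal-colouring : ∀ k → (∀ i → ∃ λ v → τ v ≡ i) → (∀ b → ColourableOn G (full G) b → suc k ≤ b) →
        suc k < m → suc k < ℓ + ℓ → RainbowColoured τ (2 + k) ℓ
      suboptimal-colouring k onto χ≥ χ<m χ<2ℓ
        with p , rp ← gallai-roy k χ≥
        with c , _ , c∉ ← longer⇒∃∉ _≟_ {zs = applyUpTo (τ ∘ p) (suc k)} (Unique.allFin⁺ m)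
               (subst₂ _<_ (≡.sym (length-applyUpTo (τ ∘ p) (suc k))) (≡.sym (length-tabulate {n = m} id)) χ<m)
        with x , refl ← onto c =
        path-and-fresh-coloured rp χ<2ℓ λ i i< eq →
          c∉ (subst (_∈ applyUpTo (τ ∘ p) (suc k)) (≡.sym eq) (∈-applyUpTo⁺ (τ ∘ p) i<))

-- The cases χ < ℓ, exactly χ colours, and more than χ colours

theorem1p11 : (ℓ : ℕ) → 3 ≤ ℓ → (G : Graph) → CycleFree (suc ℓ) G →
    ¬ IsComplete G ℓ → (χ : ℕ) → IsChromaticNumber G χ → 3 * χ < 5 * ℓ + 2 →
    DiscrepancyAtLeast G ((+ χ) - (+ ℓ) +ℤ (+ 1))
theorem1p11 (suc (suc (suc q))) (s≤s (s≤s (s≤s z≤n))) G acyclic incomplete χ (_ , χ≥) χ< (σ , σ-proper) with 3 + q ≤? χ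
-- A single vertex gives 1 - 1 = 0, and here χ - ℓ + 1 ≤ 0.
... | no ℓ≰χ = rainbow-witness G {χ} {3 + q} {0} {0} σ (λ _ → fromℕ< (nonempty G)) (λ { {zero} {zero} _ → refl })
  (λ _ → zero) (λ _ _ vv → contradiction refl (Adj⇒≢ G vv))
  (subst (_≤ 4 + q) (≡.sym (trans (+-assoc χ 1 1) (+-comm χ 2))) (s≤s (≰⇒> ℓ≰χ)))
... | yes ℓ≤χ@(s≤s {n = k} _)
  with m , τ , onto , to , from ← surjective-normalisation σ
  with m≤n⇒m<n∨m≡n (χ≥ m (τ , λ i j _ _ ij → σ-proper i j ij ∘ from))
-- χ rainbow vertices against ℓ - 1 colours give exactly χ - ℓ + 1.
...   | inj₂ refl with f , f-inj , d , d-proper ← optimal-colouring G q k acyclic incomplete ℓ≤χ τ onto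
          (λ vw → σ-proper _ _ vw ∘ from) χ≥ =
  rainbow-witness G {suc k} {3 + q} σ f (f-inj ∘ to) d d-proper
    (≤-reflexive (+-assoc (suc k) 1 (2 + q)))
-- χ + 1 rainbow vertices against ℓ colours give the same difference.
...   | inj₁ χ<m with f , f-inj , d , d-proper ← suboptimal-colouring G τ (λ vw → σ-proper _ _ vw ∘ from)
          (2 + q) acyclic k onto χ≥ χ<m (χ<ℓ+ℓ {3 + q} (s≤s (s≤s z≤n)) χ<) =
  rainbow-witness G {suc k} {3 + q} σ f (f-inj ∘ to) d d-proper
    (≤-reflexive (cong (_+ (3 + q)) (+-comm (suc k) 1)))
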